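{- The logic $\mathsf{C2.F}$ is sound and weakly complete with respect to linear order frames: for every $p\in\mathcal{L}_>$, $\vdash_{\mathsf{C2.F}}p$ if and only if $p$ is true at every world of every order model based on a linear order frame.
   Context: Language. Let $At=\{p_0,p_1,\ldots\}$ be a countably infinite set of atoms. $\mathcal{L}_>$ is generated by $p ::= p_k\in At\mid \neg p\mid (p\wedge p)\mid (p>p)$; $\vee,\to,\leftrightarrow$ are defined as usual. Logics. $\mathsf{C2}$ is the smallest set of $\mathcal{L}_>$-sentences containing all instances of: (PC) every (substitution instance of a) theorem of classical propositional logic; (Identity) $p>p$; (Reciprocity) $(p>q)\wedge(q>p)\wedge(p>r)\to(q>r)$; (MP) $(p>q)\to(p\to q)$; (CEM) $(p>q)\vee(p>\neg q)$; and closed under (Detachment) from $\vdash p\to q$ and $\vdash p$ infer $\vdash q$; (Normality) from $\vdash(p\wedge q)\to r$ infer $\vdash((s>p)\wedge(s>q))\to(s>r)$. $\mathsf{C2.F}$ is the smallest extension of $\mathsf{C2}$ containing every instance of (Flattening) $(p>((p\wedge q)>r))\leftrightarrow((p\wedge q)>r)$ and closed under Detachment and Normality. $\vdash_{\mathsf{C2.F}}p$ means $p\in\mathsf{C2.F}$. Order frames and models. An order frame is a pair $\langle W,<\rangle$ where $W\neq\varnothing$ and $<$ is a function taking each $w\in W$ to a strict well-order $<_w$ on some subset of $W$ such that whenever $x<_w y$, either $w=x$ or $w<_w x$. Its accessibility relation is $R(w)=\{w\}\cup\{v: w<_w v\}$. An order model $\langle W,<,V\rangle$ adds a valuation $V:At\times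 W\to\{0,1\}$; put $V(p_k)=\{w:V(p_k,w)=1\}$. Denotations: $[\![p_k]\!]=V(p_k)$, $[\![\neg p]\!]=W\setminus[\![p]\!]$, $[\![p\wedge q]\!]=[\![p]\!]\cap[\![q]\!]$, and $w\in[\![p>q]\!]$ iff either $R(w)\cap[\![p]\!]=\varnothing$, or there is $y\in R(w)\cap[\![p]\!]\cap[\![q]\!]$ such that $x\notin[\![p]\!]$ whenever $x<_w y$. A sentence $p$ is true at $w$ iff $w\in[\![p]\!]$. An order frame $\langle W,<\rangle$ is linear iff there is a strict partial order $\prec$ on $W$ such that for all $w,x,y\in W$: $x<_w y$ iff $w\preceq x\prec y$ (where $w\preceq x$ means $w\prec x$ or $w=x$). -}

module Defs where

open import Level using (0ℓ)
open import Data.Bool using (Bool; true; not) renaming (_∧_ to _&&_)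
open import Data.Nat using (ℕ)
open import Data.Product using (Σ; ∃; _×_; proj₁)
open import Data.Sum using (_⊎_)
open import Function using (_on_; _⇔_)
open import Induction.WellFounded using (WellFounded)
open import Relation.Binary using (Rel; IsStrictTotalOrder; IsStrictPartialOrder)
open import Relation.Binary.PropositionalEquality using (_≡_)
open import Relation.Unary using (Pred; _∈_; _∉_; _∩_; ∁; Empty)

infixr 8 ¬′_
infixr 7 _∧′_
infixr 6 _∨′_
infix  5 _>′_
infixr 4 _→′_
infix  3 _↔′_

data Form : Set where
  atom : ℕ → Form
  ¬′_  : Form → Form
  _∧′_ : Form → Form → Form
  _>′_ : Form → Form → Form

_∨′_ _→′_ _↔′_ : Form → Form → Form
p ∨′ q = ¬′ (¬′ p ∧′ ¬′ q)
p →′ q = ¬′ (p ∧′ ¬′ q)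
p ↔′ q = (p →′ q) ∧′ (q →′ p)

data Prop′ : Set where
  var : ℕ → Prop′
  neg : Prop′ → Prop′
  and : Prop′ → Prop′ → Prop′

eval : (ℕ → Bool) → Prop′ → Bool
eval v (var k)   = v k
eval v (neg a)   = not (eval v a)
eval v (and a b) = eval v a && eval v b

-- The theorems of classical propositional logic, given
-- independently of any choice of proof system.
Tautology : Prop′ → Set
Tautology a = ∀ v → eval v a ≡ true

_[_] : Prop′ → (ℕ → Form) → Form
var k   [ σ ] = σ k
neg a   [ σ ] = ¬′ (a [ σ ])
and a b [ σ ] = (a [ σ ]) ∧′ (b [ σ ])

infix 2 ⊢C2_ ⊢C2F_

data ⊢C2_ : Form → Set where
  pc          : ∀ a σ → Tautology a → ⊢C2 a [ σ ]
  identity    : ∀ p → ⊢C2 (p >′ p)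
  reciprocity : ∀ p q r →
    ⊢C2 (((p >′ q) ∧′ (q >′ p)) ∧′ (p >′ r)) →′ (q >′ r)
  mp          : ∀ p q → ⊢C2 (p >′ q) →′ (p →′ q)
  cem         : ∀ p q → ⊢C2 (p >′ q) ∨′ (p >′ (¬′ q))
  detachment  : ∀ {p q} → ⊢C2 (p →′ q) → ⊢C2 p → ⊢C2 q
  normality   : ∀ {p q r} s → ⊢C2 ((p ∧′ q) →′ r) →
    ⊢C2 ((s >′ p) ∧′ (s >′ q)) →′ (s >′ r)

data ⊢C2F_ : Form → Set where
  c2         : ∀ {p} → ⊢C2 p → ⊢C2F p
  flattening : ∀ p q r →
    ⊢C2F (p >′ ((p ∧′ q) >′ r)) ↔′ ((p ∧′ q) >′ r)
  detachment : ∀ {p q} → ⊢C2F (p →′ q) → ⊢C2F p → ⊢C2F q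
  normality  : ∀ {p q r} s → ⊢C2F ((p ∧′ q) →′ r) →
    ⊢C2F ((s >′ p) ∧′ (s >′ q)) →′ (s >′ r)

-- As a set of pairs, _<_ is contained in S × S, so it is well-founded
-- on S exactly when it is well-founded on A.
record IsStrictWellOrderOn {A : Set} (S : Pred A 0ℓ) (_<_ : Rel A 0ℓ) : Set where
  field
    supported          : ∀ {x y} → x < y → x ∈ S × y ∈ S
    isStrictTotalOrder : IsStrictTotalOrder {A = ∃ S} (_≡_ on proj₁) (_<_ on proj₁)
    wellFounded        : WellFounded _<_

record OrderFrame : Set₁ where
  field
    W        : Set
    nonEmpty : W
    order    : W → Rel W 0ℓ
    domain   : W → Pred W 0ℓ
    isStrictWellOrderOn : ∀ w → IsStrictWellOrderOn (domain w) (order w)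

  infix 4 _<[_]_
  _<[_]_ : W → W → W → Set
  x <[ w ] y = order w x y

  field
    centred : ∀ {w x y} → x <[ w ] y → w ≡ x ⊎ w <[ w ] x

  R : W → Pred W 0ℓ
  R w v = v ≡ w ⊎ w <[ w ] v

IsLinear : OrderFrame → Set₁
IsLinear F =
  Σ (Rel W 0ℓ) λ _≺_ →
    IsStrictPartialOrder _≡_ _≺_ ×
    (∀ w x y → x <[ w ] y ⇔ ((w ≺ x ⊎ w ≡ x) × x ≺ y))
  where open OrderFrame F

record OrderModel : Set₁ where
  field
    frame : OrderFrame

  open OrderFrame frame public

  field
    V : ℕ → W → Bool

  ⟦_⟧ : Form → Pred W 0ℓ
  ⟦ atom k ⟧ w = V k w ≡ true
  ⟦ ¬′ p   ⟧   = ∁ ⟦ p ⟧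
  ⟦ p ∧′ q ⟧   = ⟦ p ⟧ ∩ ⟦ q ⟧
  ⟦ p >′ q ⟧ w =
    Empty (R w ∩ ⟦ p ⟧) ⊎
    ∃ λ y → y ∈ (R w ∩ ⟦ p ⟧ ∩ ⟦ q ⟧) × (∀ x → x <[ w ] y → x ∉ ⟦ p ⟧)

  TrueAt : Form → W → Set
  TrueAt p w = w ∈ ⟦ p ⟧

{-# OPTIONS --safe #-}
-- Completeness builds a labelled well-order below ω^ω. Let T be a complete theory omitting the
-- given sentence. The theories f(p, T) = { q : p > q ∈ T } are again complete, and Flattening
-- says f(p, T) = f(p, f(s, T)) whenever p entails s. Fix finitely many "types" deciding the
-- antecedents that occur in the sentence. For a set S of types, a word of theories is built from
-- T up to the exit f(¬⋁S, T), by recursion on |S|: leave S ∖ s₀ from T, then S ∖ s₁ from there,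
-- and so on, cycling through S, and concatenate the words. If the process never leaves S, every
-- type recurs cofinally, so conditionals whose antecedent occurs no more depend on the exit only.
module Submission where

open import Defs
open import Level using (0ℓ)
open import Axiom.ExcludedMiddle using (ExcludedMiddle)
open import Data.Bool using (Bool; true; false) renaming (_∧_ to _&&_)
open import Data.Bool.Properties using (∧-conicalˡ; ∧-conicalʳ)
open import Data.Empty using (⊥-elim)
open import Data.Fin using (Fin; zero; suc; toℕ; fromℕ<; punchIn; punchOut; _≟_)
open import Data.Fin.Properties using (punchIn-punchOut; toℕ-fromℕ<; toℕ-injective; toℕ<n)
open import Data.List using (List; []; _∷_; _++_; map; lookup; length; cartesianProductWith)
open import Data.List.Membership.Propositional using (_∈_)
open import Data.List.Membership.Propositional.Properties
  using (∈-++⁺ˡ; ∈-++⁺ʳ; ∈-++⁻; ∈-map⁺; ∈-map⁻; ∈-cartesianProductWith⁺; ∈-lookup)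
open import Data.List.Relation.Unary.Any using (here; there; index)
open import Data.List.Relation.Unary.Any.Properties using (lookup-index)
open import Data.Nat
  using (ℕ; zero; suc; _+_; _*_; _⊔_; _≤_; _<_; _≤′_; ≤′-refl; ≤′-step)
open import Data.Nat.DivMod
  using (_%_; _/_; m%n<n; m≡m%n+[m/n]*n; [m+kn]%n≡m%n; m<n⇒m%n≡m; n%n≡0)
open import Data.Nat.Induction using (<-wellFounded)
open import Data.Nat.Properties
  using (≤⇒≤′; ≤′⇒≤; ≤-trans; ≤-refl; m≤n⇒m≤1+n; <-trans; <-cmp; m≤m*n; m≤n+m; m≤m⊔n; m≤n⊔m;
         m≤n⇒m<n∨m≡n; 1+n≢n; z≤′n)
open import Data.Product using (∃; _×_; _,_; proj₁; proj₂)
open import Data.Sum using (_⊎_; inj₁; inj₂; [_,_]′) renaming (map to ⊎-map)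
open import Data.Unit using (⊤; tt)
open import Data.Vec.Functional using (removeAt)
open import Function using (_∘_; _⇔_; mk⇔; id)
open import Function.Bundles using (module Equivalence)
open import Function.Construct.Composition using (_⇔-∘_)
open import Function.Construct.Identity using (⇔-id)
open import Function.Construct.Symmetry using (⇔-sym)
open import Induction.WellFounded using (WellFounded; Acc; acc; wf⇒asym)
open import Relation.Binary
  using (Rel; IsStrictTotalOrder; IsStrictPartialOrder; Trichotomous; tri<; tri≈; tri>)
import Relation.Binary.Construct.On as On
open import Relation.Binary.PropositionalEquality
  using (_≡_; _≢_; refl; sym; trans; cong; subst; isEquivalence; module ≡-Reasoning)
open import Relation.Nullary using (¬_; yes; no; does; contradiction; decidable-stable)
open import Relation.Unary using (Pred)

open Equivalence using (to; from)

-- Soundness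

minimal : ExcludedMiddle 0ℓ → {A : Set} {_<_ : Rel A 0ℓ} → WellFounded _<_ →
  (P : Pred A 0ℓ) → ∃ P → ∃ λ y → P y × (∀ x → x < y → ¬ P x)
minimal em {_<_ = _<_} wf P (y , Py) = go y (wf y) Py
  where
  go : ∀ y → Acc _<_ y → P y → ∃ λ z → P z × (∀ x → x < z → ¬ P x)
  go y (acc rs) Py with em {∃ λ x → x < y × P x}
  ... | yes (x , x<y , Px) = go x (rs x<y) Px
  ... | no  none           = y , Py , λ x x<y Px → none (x , x<y , Px)

module Soundness (em : ExcludedMiddle 0ℓ) (M : OrderModel)
                 (linear : IsLinear (OrderModel.frame M)) where

  open OrderModel M

  private
    _≺_ : Rel W 0ℓ
    _≺_ = proj₁ linear

    open IsStrictPartialOrder (proj₁ (proj₂ linear))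
      using (irrefl) renaming (trans to ≺-trans)

    order⇔ : ∀ w x y → x <[ w ] y ⇔ ((w ≺ x ⊎ w ≡ x) × x ≺ y)
    order⇔ = proj₂ (proj₂ linear)

    _⪯_ : Rel W 0ℓ
    x ⪯ y = x ≺ y ⊎ x ≡ y

  ⪯-refl : ∀ {w} → w ⪯ w
  ⪯-refl = inj₂ refl

  ⪯-≺-trans : ∀ {x y z} → x ⪯ y → y ≺ z → x ≺ z
  ⪯-≺-trans (inj₁ x≺y)  y≺z = ≺-trans x≺y y≺z
  ⪯-≺-trans (inj₂ refl) y≺z = y≺z

  ⪯-trans : ∀ {x y z} → x ⪯ y → y ⪯ z → x ⪯ z
  ⪯-trans x⪯y (inj₁ y≺z)  = inj₁ (⪯-≺-trans x⪯y y≺z)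
  ⪯-trans x⪯y (inj₂ refl) = x⪯y

  R⇒⪯ : ∀ {w x} → R w x → w ⪯ x
  R⇒⪯ (inj₁ refl) = ⪯-refl
  R⇒⪯ (inj₂ w<x)  = inj₁ (proj₂ (to (order⇔ _ _ _) w<x))

  ⪯⇒R : ∀ {w x} → w ⪯ x → R w x
  ⪯⇒R (inj₁ w≺x)  = inj₂ (from (order⇔ _ _ _) (⪯-refl , w≺x))
  ⪯⇒R (inj₂ refl) = inj₁ refl

  -- Although `≺` is only a partial order, all points strictly above w lie in the domain of the
  -- order at w, which is total.
  ⪯-connex : ∀ {w y z} → w ⪯ y → w ⪯ z → y ⪯ z ⊎ z ≺ y
  ⪯-connex (inj₂ refl) w⪯z         = inj₁ w⪯z
  ⪯-connex (inj₁ w≺y)  (inj₂ refl) = inj₂ w≺y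
  ⪯-connex {w} {y} {z} (inj₁ w≺y) (inj₁ w≺z)
    with compare (y , domain-above w≺y) (z , domain-above w≺z)
    where
    open IsStrictWellOrderOn (isStrictWellOrderOn w)
    open IsStrictTotalOrder isStrictTotalOrder using (compare)
    domain-above : ∀ {x} → w ≺ x → domain w x
    domain-above w≺x = proj₂ (supported (from (order⇔ _ _ _) (⪯-refl , w≺x)))
  ... | tri< y<z _ _  = inj₁ (inj₁ (proj₂ (to (order⇔ _ _ _) y<z)))
  ... | tri≈ _ refl _ = inj₁ ⪯-refl
  ... | tri> _ _ z<y  = inj₂ (proj₂ (to (order⇔ _ _ _) z<y))

  -- The semantic clause for `>′` restated through `≺` alone: y is the first p-world at or after w.
  Selected : Form → W → Pred W 0ℓ
  Selected p w y = w ⪯ y × ⟦ p ⟧ y × (∀ x → w ⪯ x → x ≺ y → ¬ ⟦ p ⟧ x)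

  select : ∀ p {w y} → w ⪯ y → ⟦ p ⟧ y → ∃ (Selected p w)
  select p {w} {y} w⪯y py
    with z , (w⪯z , pz) , least ←
      minimal em (IsStrictWellOrderOn.wellFounded (isStrictWellOrderOn w))
        (λ x → w ⪯ x × ⟦ p ⟧ x) (y , w⪯y , py)
    = z , w⪯z , pz , λ x w⪯x x≺z px →
        least x (from (order⇔ _ _ _) (w⪯x , x≺z)) (w⪯x , px)

  selected-least : ∀ p {w y z} → Selected p w y → w ⪯ z → ⟦ p ⟧ z → y ⪯ z
  selected-least p (w⪯y , _ , least) w⪯z pz with ⪯-connex w⪯y w⪯z
  ... | inj₁ y⪯z = y⪯z
  ... | inj₂ z≺y = contradiction pz (least _ w⪯z z≺y)

  selected-unique : ∀ p {w y z} → Selected p w y → Selected p w z → y ≡ z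
  selected-unique p sy@(w⪯y , py , _) (w⪯z , pz , least) with selected-least p sy w⪯z pz
  ... | inj₂ y≡z = y≡z
  ... | inj₁ y≺z = contradiction py (least _ w⪯y y≺z)

  -- A selected world exists as soon as some p-world is accessible, and it is unique. The universal
  -- form therefore covers the vacuous case as well and spares the soundness proofs a case split.
  >′⇔ : ∀ p q {w} → ⟦ p >′ q ⟧ w ⇔ (∀ y → Selected p w y → ⟦ q ⟧ y)
  >′⇔ p q {w} = mk⇔ f g
    where
    f : ⟦ p >′ q ⟧ w → ∀ y → Selected p w y → ⟦ q ⟧ y
    f (inj₁ none) y (w⪯y , py , _) = ⊥-elim (none y (⪯⇒R w⪯y , py))
    f (inj₂ (z , (Rwz , pz , qz) , least)) y sy =
      subst ⟦ q ⟧ (selected-unique p sz sy) qz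
      where
      sz : Selected p w z
      sz = R⇒⪯ Rwz , pz , λ x w⪯x x≺z → least x (from (order⇔ _ _ _) (w⪯x , x≺z))
    g : (∀ y → Selected p w y → ⟦ q ⟧ y) → ⟦ p >′ q ⟧ w
    g h with em {∃ λ y → R w y × ⟦ p ⟧ y}
    ... | no none = inj₁ λ y Rpy → none (y , Rpy)
    ... | yes (y , Rwy , py)
      with z , sz@(w⪯z , pz , least) ← select p (R⇒⪯ Rwy) py
      = inj₂ (z , (⪯⇒R w⪯z , pz , h z sz) , λ x x<z →
          let w⪯x , x≺z = to (order⇔ _ _ _) x<z in least x w⪯x x≺z)

  stable : ∀ {P : Set} → ¬ ¬ P → P
  stable = decidable-stable em

  →′⇔ : ∀ p q {w} → ⟦ p →′ q ⟧ w ⇔ (⟦ p ⟧ w → ⟦ q ⟧ w)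
  →′⇔ p q = mk⇔ (λ h pw → stable λ ¬qw → h (pw , ¬qw)) (λ h (pw , ¬qw) → ¬qw (h pw))

  eval⇔ : ∀ σ {w} (v : ℕ → Bool) → (∀ k → v k ≡ true ⇔ ⟦ σ k ⟧ w) →
    ∀ a → eval v a ≡ true ⇔ ⟦ a [ σ ] ⟧ w
  eval⇔ σ v v⇔ (var k)   = v⇔ k
  eval⇔ σ v v⇔ (neg a) with eval v a in eq | eval⇔ σ v v⇔ a
  ... | true  | ih = mk⇔ (λ ()) (λ ¬a → contradiction (to ih refl) ¬a)
  ... | false | ih = mk⇔ (λ _ aw → contradiction (from ih aw) λ ()) (λ _ → refl)
  eval⇔ σ v v⇔ (and a b) with eval v a | eval v b | eval⇔ σ v v⇔ a | eval⇔ σ v v⇔ b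
  ... | true  | true  | iha | ihb = mk⇔ (λ _ → to iha refl , to ihb refl) (λ _ → refl)
  ... | true  | false | iha | ihb = mk⇔ (λ ()) (λ (_ , bw) → from ihb bw)
  ... | false | _     | iha | ihb = mk⇔ (λ ()) (λ (aw , _) → from iha aw)

  tautology-sound : ∀ a σ → Tautology a → ∀ w → ⟦ a [ σ ] ⟧ w
  tautology-sound a σ taut w = to (eval⇔ σ v v⇔ a) (taut v)
    where
    v : ℕ → Bool
    v k = does (em {⟦ σ k ⟧ w})
    v⇔ : ∀ k → v k ≡ true ⇔ ⟦ σ k ⟧ w
    v⇔ k with em {⟦ σ k ⟧ w}
    ... | yes σw = mk⇔ (λ _ → σw) (λ _ → refl)
    ... | no ¬σw = mk⇔ (λ ()) (λ σw → contradiction σw ¬σw)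

  detachment-sound : ∀ p q → (∀ w → ⟦ p →′ q ⟧ w) → (∀ w → ⟦ p ⟧ w) → ∀ w → ⟦ q ⟧ w
  detachment-sound p q ⊨pq ⊨p w = to (→′⇔ p q) (⊨pq w) (⊨p w)

  normality-sound : ∀ p q r s → (∀ w → ⟦ (p ∧′ q) →′ r ⟧ w) →
    ∀ w → ⟦ ((s >′ p) ∧′ (s >′ q)) →′ (s >′ r) ⟧ w
  normality-sound p q r s ⊨pqr w =
    from (→′⇔ ((s >′ p) ∧′ (s >′ q)) (s >′ r)) λ (sp , sq) →
    from (>′⇔ s r) λ y sel →
    to (→′⇔ (p ∧′ q) r) (⊨pqr y) (to (>′⇔ s p) sp y sel , to (>′⇔ s q) sq y sel)

  C2-sound : ∀ {p} → ⊢C2 p → ∀ w → ⟦ p ⟧ w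
  C2-sound (pc a σ taut) = tautology-sound a σ taut
  C2-sound (identity p) w = from (>′⇔ p p) λ y (_ , py , _) → py
  C2-sound (reciprocity p q r) w =
    from (→′⇔ (((p >′ q) ∧′ (q >′ p)) ∧′ (p >′ r)) (q >′ r)) λ ((pq , qp) , pr) →
    from (>′⇔ q r) λ y sy@(w⪯y , qy , least) →
    to (>′⇔ p r) pr y (w⪯y , to (>′⇔ q p) qp y sy , λ x w⪯x x≺y px →
      let z , sz@(w⪯z , _ , _) = select p w⪯x px
          z⪯x = selected-least p sz w⪯x px
      in least z w⪯z (⪯-≺-trans z⪯x x≺y) (to (>′⇔ p q) pq z sz))
  C2-sound (mp p q) w =
    from (→′⇔ (p >′ q) (p →′ q)) λ pq → from (→′⇔ p q) λ pw →
    to (>′⇔ p q) pq w (⪯-refl , pw , λ x w⪯x x≺w _ → irrefl refl (⪯-≺-trans w⪯x x≺w))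
  C2-sound (cem p q) w (¬pq , ¬p¬q) =
    ¬pq (from (>′⇔ p q) λ y sy → stable λ ¬qy →
    ¬p¬q (from (>′⇔ p (¬′ q)) λ z sz → subst (λ u → ¬ ⟦ q ⟧ u) (selected-unique p sy sz) ¬qy))
  C2-sound (detachment {p} {q} d e) = detachment-sound p q (C2-sound d) (C2-sound e)
  C2-sound (normality {p} {q} {r} s d) = normality-sound p q r s (C2-sound d)

  -- A world of the conjunction at or after w is a p-world, hence not before y. So the searches from
  -- w and from y find the same world, which yields both halves of Flattening.
  selected-∧ : ∀ p q {w y z} → Selected p w y →
    Selected (p ∧′ q) w z ⇔ Selected (p ∧′ q) y z
  selected-∧ p q {w} {y} {z} sy@(w⪯y , _ , _) = mk⇔ f g
    where
    f : Selected (p ∧′ q) w z → Selected (p ∧′ q) y z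
    f (w⪯z , pqz , least) =
      selected-least p sy w⪯z (proj₁ pqz) , pqz , λ x y⪯x → least x (⪯-trans w⪯y y⪯x)
    g : Selected (p ∧′ q) y z → Selected (p ∧′ q) w z
    g (y⪯z , pqz , least) =
      ⪯-trans w⪯y y⪯z , pqz , λ x w⪯x x≺z pqx →
        least x (selected-least p sy w⪯x (proj₁ pqx)) x≺z pqx

  flattening-sound : ∀ p q r w →
    ⟦ (p >′ ((p ∧′ q) >′ r)) ↔′ ((p ∧′ q) >′ r) ⟧ w
  flattening-sound p q r w = from (→′⇔ nested flat) f , from (→′⇔ flat nested) g
    where
    flat nested : Form
    flat   = (p ∧′ q) >′ r
    nested = p >′ flat
    f : ⟦ nested ⟧ w → ⟦ flat ⟧ w
    f h = from (>′⇔ (p ∧′ q) r) λ z sz@(w⪯z , (pz , _) , _) →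
      let y , sy = select p w⪯z pz
      in to (>′⇔ (p ∧′ q) r) (to (>′⇔ p flat) h y sy) z (to (selected-∧ p q sy) sz)
    g : ⟦ flat ⟧ w → ⟦ nested ⟧ w
    g h = from (>′⇔ p flat) λ y sy → from (>′⇔ (p ∧′ q) r) λ z sz →
      to (>′⇔ (p ∧′ q) r) h z (from (selected-∧ p q sy) sz)

  C2F-sound : ∀ {p} → ⊢C2F p → ∀ w → ⟦ p ⟧ w
  C2F-sound (c2 d)                 = C2-sound d
  C2F-sound (flattening p q r)     = flattening-sound p q r
  C2F-sound (detachment {p} {q} d e) = detachment-sound p q (C2F-sound d) (C2F-sound e)
  C2F-sound (normality {p} {q} {r} s d) = normality-sound p q r s (C2F-sound d)

-- Derivations and complete theories

infixr 4 _⇒_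
_⇒_ : Prop′ → Prop′ → Prop′
a ⇒ b = neg (and a (neg b))

assign : {A : Set} → A → A → A → ℕ → A
assign x y z 0 = x
assign x y z 1 = y
assign x y z _ = z

everyBool : (Bool → Bool) → Bool
everyBool f = f false && f true

everyBool-sound : ∀ f → everyBool f ≡ true → ∀ b → f b ≡ true
everyBool-sound f h false = ∧-conicalˡ _ _ h
everyBool-sound f h true  = ∧-conicalʳ (f false) _ h

-- Checks the eight rows of a truth table, so that `refl` proves each tautology below by
-- computation.
everyBool³ : (Bool → Bool → Bool → Bool) → Bool
everyBool³ f = everyBool λ x → everyBool λ y → everyBool λ z → f x y z

everyBool³-sound : ∀ f → everyBool³ f ≡ true → ∀ x y z → f x y z ≡ true
everyBool³-sound f h x y =
  everyBool-sound (f x y)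
    (everyBool-sound (λ y → everyBool (f x y))
      (everyBool-sound (λ x → everyBool λ y → everyBool (f x y)) h x) y)

-- The second argument, refl for a closed term a, says that a has no variables but var 0, var 1, var 2.
tautology : ∀ a → (∀ v → eval (assign (v 0) (v 1) (v 2)) a ≡ eval v a) →
  everyBool³ (λ x y z → eval (assign x y z) a) ≡ true → ∀ p q r → ⊢C2F a [ assign p q r ]
tautology a ternary table p q r = c2 (pc a (assign p q r) λ v →
  trans (sym (ternary v))
    (everyBool³-sound (λ x y z → eval (assign x y z) a) table (v 0) (v 1) (v 2)))

X Y Z : Prop′
X = var 0
Y = var 1
Z = var 2

⊤′ : Form
⊤′ = ¬′ (atom 0 ∧′ ¬′ atom 0)

⊢⊤ : ⊢C2F ⊤′
⊢⊤ = tautology (X ⇒ X) (λ _ → refl) refl (atom 0) (atom 0) (atom 0)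

⊢refl : ∀ p → ⊢C2F p →′ p
⊢refl p = tautology (X ⇒ X) (λ _ → refl) refl p p p

⊢trans : ∀ {p q r} → ⊢C2F p →′ q → ⊢C2F q →′ r → ⊢C2F p →′ r
⊢trans {p} {q} {r} pq qr = detachment (detachment
  (tautology ((X ⇒ Y) ⇒ (Y ⇒ Z) ⇒ (X ⇒ Z)) (λ _ → refl) refl p q r) pq) qr

⊢proj₁ : ∀ p q → ⊢C2F (p ∧′ q) →′ p
⊢proj₁ p q = tautology (and X Y ⇒ X) (λ _ → refl) refl p q q

⊢proj₂ : ∀ p q → ⊢C2F (p ∧′ q) →′ q
⊢proj₂ p q = tautology (and X Y ⇒ Y) (λ _ → refl) refl p q q

⊢pair : ∀ {p q r} → ⊢C2F p →′ q → ⊢C2F p →′ r → ⊢C2F p →′ (q ∧′ r)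
⊢pair {p} {q} {r} pq pr = detachment (detachment
  (tautology ((X ⇒ Y) ⇒ (X ⇒ Z) ⇒ (X ⇒ and Y Z)) (λ _ → refl) refl p q r) pq) pr

⊢const : ∀ {p q} → ⊢C2F q → ⊢C2F p →′ q
⊢const {p} {q} d = detachment (tautology (Y ⇒ X ⇒ Y) (λ _ → refl) refl p q q) d

⊢contrapose : ∀ {p q} → ⊢C2F p →′ (¬′ q) → ⊢C2F q →′ (¬′ p)
⊢contrapose {p} {q} = detachment
  (tautology ((X ⇒ neg Y) ⇒ (Y ⇒ neg X)) (λ _ → refl) refl p q q)

⊢stable : ∀ {p} → ⊢C2F ¬′ (¬′ p) → ⊢C2F p
⊢stable {p} = detachment (tautology (neg (neg X) ⇒ X) (λ _ → refl) refl p p p)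

⊢mp : ∀ p q → ⊢C2F ((p →′ q) ∧′ p) →′ q
⊢mp p q = tautology (and (X ⇒ Y) X ⇒ Y) (λ _ → refl) refl p q q

⊢explode : ∀ p q → ⊢C2F (p ∧′ (¬′ p)) →′ q
⊢explode p q = tautology (and X (neg X) ⇒ Y) (λ _ → refl) refl p q q

⊢resolve : ∀ p q → ⊢C2F ((p ∨′ q) ∧′ (¬′ p)) →′ q
⊢resolve p q = tautology (and (neg (and (neg X) (neg Y))) (neg X) ⇒ Y) (λ _ → refl) refl p q q

⊢cases : ∀ {p q} → ⊢C2F ¬′ (p ∧′ q) → ⊢C2F ¬′ (p ∧′ (¬′ q)) → ⊢C2F ¬′ p
⊢cases {p} {q} d e = detachment (detachment
  (tautology (neg (and X Y) ⇒ neg (and X (neg Y)) ⇒ neg X) (λ _ → refl) refl p q q) d) e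

-- The set of all formulas counts as complete, so that f(p, T) is a complete theory even when T
-- contains `p >′ q` for every q.
record IsCompleteTheory (T : Pred Form 0ℓ) : Set where
  field
    closed   : ∀ {p q} → ⊢C2F p →′ q → T p → T q
    ∧-intro  : ∀ {p q} → T p → T q → T (p ∧′ q)
    theorems : ∀ {p} → ⊢C2F p → T p
    complete : ∀ p → T p ⊎ T (¬′ p)

  modusPonens : ∀ {p q} → T (p →′ q) → T p → T q
  modusPonens {p} {q} pq p∈T = closed (⊢mp p q) (∧-intro pq p∈T)

  explode : ∀ {p q} → T p → T (¬′ p) → T q
  explode {p} {q} p∈T ¬p∈T = closed (⊢explode p q) (∧-intro p∈T ¬p∈T)

  resolve : ∀ {p q} → T (p ∨′ q) → T (¬′ p) → T q
  resolve {p} {q} p∨q ¬p = closed (⊢resolve p q) (∧-intro p∨q ¬p)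

-- Maximal consistent extensions

module Lindenbaum (em : ExcludedMiddle 0ℓ) where

  Consistent : Pred Form 0ℓ
  Consistent p = ¬ (⊢C2F ¬′ p)

  settle : Form → Form → Form
  settle c p with em {Consistent (c ∧′ p)}
  ... | yes _ = c ∧′ p
  ... | no  _ = c ∧′ (¬′ p)

  settle-extends : ∀ c p → ⊢C2F settle c p →′ c
  settle-extends c p with em {Consistent (c ∧′ p)}
  ... | yes _ = ⊢proj₁ c p
  ... | no  _ = ⊢proj₁ c (¬′ p)

  settle-consistent : ∀ c p → Consistent c → Consistent (settle c p)
  settle-consistent c p con with em {Consistent (c ∧′ p)}
  ... | yes con′ = con′
  ... | no ¬con′ = λ d → ¬con′ λ e → con (⊢cases e d)

  settle-decides : ∀ c p → ⊢C2F settle c p →′ p ⊎ ⊢C2F settle c p →′ (¬′ p)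
  settle-decides c p with em {Consistent (c ∧′ p)}
  ... | yes _ = inj₁ (⊢proj₂ c p)
  ... | no  _ = inj₂ (⊢proj₂ c (¬′ p))

  settleAll : Form → List Form → Form
  settleAll c []       = c
  settleAll c (p ∷ ps) = settleAll (settle c p) ps

  settleAll-extends : ∀ c ps → ⊢C2F settleAll c ps →′ c
  settleAll-extends c []       = ⊢refl c
  settleAll-extends c (p ∷ ps) = ⊢trans (settleAll-extends (settle c p) ps) (settle-extends c p)

  settleAll-consistent : ∀ c ps → Consistent c → Consistent (settleAll c ps)
  settleAll-consistent c []       con = con
  settleAll-consistent c (p ∷ ps) con = settleAll-consistent _ ps (settle-consistent c p con)

  settleAll-decides : ∀ c {p} ps → p ∈ ps →
    ⊢C2F settleAll c ps →′ p ⊎ ⊢C2F settleAll c ps →′ (¬′ p)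
  settleAll-decides c (p ∷ ps) (here refl) with settle-decides c p
  ... | inj₁ d = inj₁ (⊢trans (settleAll-extends _ ps) d)
  ... | inj₂ d = inj₂ (⊢trans (settleAll-extends _ ps) d)
  settleAll-decides c (p ∷ ps) (there p∈ps) = settleAll-decides _ ps p∈ps

  -- Each stage is finite and adds one atom and one layer of connectives; together they exhaust the
  -- language, so settling one list per stage takes the place of a numbering of formulas.
  forms : ℕ → List Form
  forms zero    = []
  forms (suc n) = forms n ++ atom n ∷ map ¬′_ (forms n) ++
    cartesianProductWith _∧′_ (forms n) (forms n) ++
    cartesianProductWith _>′_ (forms n) (forms n)

  forms-mono : ∀ {m n p} → m ≤′ n → p ∈ forms m → p ∈ forms n
  forms-mono ≤′-refl       p∈ = p∈
  forms-mono (≤′-step m≤n) p∈ = ∈-++⁺ˡ (forms-mono m≤n p∈)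

  forms-⊔ : ∀ {m n p q} → p ∈ forms m → q ∈ forms n → p ∈ forms (m ⊔ n) × q ∈ forms (m ⊔ n)
  forms-⊔ {m} {n} p∈ q∈ =
    forms-mono (≤⇒≤′ (m≤m⊔n m n)) p∈ , forms-mono (≤⇒≤′ (m≤n⊔m m n)) q∈

  forms-exhaustive : ∀ p → ∃ λ n → p ∈ forms n
  forms-exhaustive (atom k) = suc k , ∈-++⁺ʳ (forms k) (here refl)
  forms-exhaustive (¬′ p) with n , p∈ ← forms-exhaustive p =
    suc n , ∈-++⁺ʳ (forms n) (there (∈-++⁺ˡ (∈-map⁺ ¬′_ p∈)))
  forms-exhaustive (p ∧′ q)
    with m , p∈ ← forms-exhaustive p | n , q∈ ← forms-exhaustive q
    with p∈ , q∈ ← forms-⊔ {m} {n} p∈ q∈ =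
    suc (m ⊔ n) , ∈-++⁺ʳ (forms (m ⊔ n)) (there (∈-++⁺ʳ (map ¬′_ (forms (m ⊔ n)))
      (∈-++⁺ˡ (∈-cartesianProductWith⁺ _∧′_ p∈ q∈))))
  forms-exhaustive (p >′ q)
    with m , p∈ ← forms-exhaustive p | n , q∈ ← forms-exhaustive q
    with p∈ , q∈ ← forms-⊔ {m} {n} p∈ q∈ =
    suc (m ⊔ n) , ∈-++⁺ʳ (forms (m ⊔ n)) (there (∈-++⁺ʳ (map ¬′_ (forms (m ⊔ n)))
      (∈-++⁺ʳ (cartesianProductWith _∧′_ (forms (m ⊔ n)) (forms (m ⊔ n)))
      (∈-cartesianProductWith⁺ _>′_ p∈ q∈))))

  module _ (c : Form) (con : Consistent c) where

    stage : ℕ → Form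
    stage zero    = c
    stage (suc n) = settleAll (stage n) (forms n)

    stage-consistent : ∀ n → Consistent (stage n)
    stage-consistent zero    = con
    stage-consistent (suc n) = settleAll-consistent _ (forms n) (stage-consistent n)

    stage-mono : ∀ {m n} → m ≤′ n → ⊢C2F stage n →′ stage m
    stage-mono ≤′-refl               = ⊢refl _
    stage-mono (≤′-step {n} m≤n) = ⊢trans (settleAll-extends _ (forms n)) (stage-mono m≤n)

    -- Each stage is a single formula entailing the earlier ones, so the sets of consequences of the
    -- stages form an increasing union.
    extension : Pred Form 0ℓ
    extension p = ∃ λ n → ⊢C2F stage n →′ p

    extension-base : extension c
    extension-base = 0 , ⊢refl c

    extension-isCompleteTheory : IsCompleteTheory extension
    extension-isCompleteTheory = record
      { closed   = λ d (n , e) → n , ⊢trans e d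
      ; ∧-intro  = λ (m , d) (n , e) → m ⊔ n ,
          ⊢pair (⊢trans (stage-mono (≤⇒≤′ (m≤m⊔n m n))) d)
                (⊢trans (stage-mono (≤⇒≤′ (m≤n⊔m m n))) e)
      ; theorems = λ d → 0 , ⊢const d
      ; complete = decide
      }
      where
      decide : ∀ p → extension p ⊎ extension (¬′ p)
      decide p with n , p∈ ← forms-exhaustive p
        with settleAll-decides (stage n) (forms n) p∈
      ... | inj₁ d = inj₁ (suc n , d)
      ... | inj₂ d = inj₂ (suc n , d)

    extension-consistent : ∀ {p} → extension p → ¬ extension (¬′ p)
    extension-consistent {p} p∈ ¬p∈
      -- Otherwise `¬′ ⊤′` follows from some stage, and contraposition refutes that stage.
      with n , d ← IsCompleteTheory.explode extension-isCompleteTheory {q = ¬′ ⊤′} p∈ ¬p∈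
      = stage-consistent n (detachment (⊢contrapose d) ⊢⊤)

-- Labelled well-orders

-- lim f is the ω-fold concatenation f 0, f 1, …
data Word (A : Set) : Set where
  nil  : Word A
  leaf : A → Word A
  lim  : (ℕ → Word A) → Word A

module _ {A : Set} where

  data Pos : Word A → Set where
    here : ∀ {a} → Pos (leaf a)
    at   : ∀ {f} k → Pos (f k) → Pos (lim f)

  label : ∀ {u} → Pos u → A
  label (here {a}) = a
  label (at k i)   = label i

  infix 4 _≺_ _⪯_

  data _≺_ : ∀ {u} → Rel (Pos u) 0ℓ where
    outer : ∀ {f k l} {i : Pos (f k)} {j : Pos (f l)} → k < l → at {f} k i ≺ at l j
    inner : ∀ {f k} {i j : Pos (f k)} → i ≺ j → at {f} k i ≺ at k j

  _⪯_ : ∀ {u} → Rel (Pos u) 0ℓ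
  i ⪯ j = i ≺ j ⊎ i ≡ j

  ≺-trans : ∀ {u} {i j k : Pos u} → i ≺ j → j ≺ k → i ≺ k
  ≺-trans (outer k<l) (outer l<m) = outer (<-trans k<l l<m)
  ≺-trans (outer k<l) (inner _)   = outer k<l
  ≺-trans (inner _)   (outer k<l) = outer k<l
  ≺-trans (inner i≺j) (inner j≺k) = inner (≺-trans i≺j j≺k)

  ⪯-≺-trans : ∀ {u} {i j k : Pos u} → i ⪯ j → j ≺ k → i ≺ k
  ⪯-≺-trans (inj₁ i≺j)  j≺k = ≺-trans i≺j j≺k
  ⪯-≺-trans (inj₂ refl) j≺k = j≺k

  -- Lexicographic induction: first on the block index, then on accessibility within the block. A
  -- step to an earlier block restarts the second induction, with accessibility there supplied by
  -- recursion on the word.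
  ≺-wellFounded : ∀ u → WellFounded (_≺_ {u})
  ≺-wellFounded (leaf a) here     = acc λ ()
  ≺-wellFounded (lim f)  (at k i) = acc-at k (<-wellFounded k) (≺-wellFounded (f k) i)
    where
    acc-at : ∀ k → Acc _<_ k → ∀ {i : Pos (f k)} → Acc _≺_ i → Acc _≺_ (at {f} k i)
    before : ∀ k → Acc _<_ k → ∀ {i : Pos (f k)} → Acc _≺_ i → ∀ {j} → j ≺ at {f} k i → Acc _≺_ j
    acc-at k ak ai = acc (before k ak ai)
    before k (acc rk) ai       (outer {k = l} {i = j} l<k) = acc-at l (rk l<k) (≺-wellFounded (f l) j)
    before k ak       (acc ri) (inner j≺i)                 = acc-at k ak (ri j≺i)

  ≺-asym : ∀ {u} {i j : Pos u} → i ≺ j → ¬ j ≺ i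
  ≺-asym {u} = wf⇒asym (≺-wellFounded u)

  ≺-irrefl : ∀ {u} {i j : Pos u} → i ≡ j → ¬ i ≺ j
  ≺-irrefl refl i≺i = ≺-asym i≺i i≺i

  ≺-connex : ∀ {u} (i j : Pos u) → i ⪯ j ⊎ j ≺ i
  ≺-connex here     here     = inj₁ (inj₂ refl)
  ≺-connex (at k i) (at l j) with <-cmp k l
  ... | tri< k<l _ _ = inj₁ (inj₁ (outer k<l))
  ... | tri> _ _ l<k = inj₂ (outer l<k)
  ... | tri≈ _ refl _ with ≺-connex i j
  ...   | inj₁ (inj₁ i≺j)  = inj₁ (inj₁ (inner i≺j))
  ...   | inj₁ (inj₂ refl) = inj₁ (inj₂ refl)
  ...   | inj₂ j≺i         = inj₂ (inner j≺i)

  ≺-cmp : ∀ {u} → Trichotomous _≡_ (_≺_ {u})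
  ≺-cmp i j with ≺-connex i j
  ... | inj₁ (inj₁ i≺j) = tri< i≺j (λ i≡j → ≺-irrefl i≡j i≺j) (≺-asym i≺j)
  ... | inj₁ (inj₂ i≡j) = tri≈ (≺-irrefl i≡j) i≡j (≺-irrefl (sym i≡j))
  ... | inj₂ j≺i        = tri> (≺-asym j≺i) (λ i≡j → ≺-irrefl (sym i≡j) j≺i) j≺i

  ≺-isStrictPartialOrder : ∀ {u} → IsStrictPartialOrder _≡_ (_≺_ {u})
  ≺-isStrictPartialOrder = record
    { isEquivalence = isEquivalence
    ; irrefl        = ≺-irrefl
    ; trans         = ≺-trans
    ; <-resp-≈      = (λ { refl i≺j → i≺j }) , λ { refl i≺j → i≺j }
    }

  -- The order at w is by definition the right-hand side of the linearity condition for `≺`.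
  wordFrame : ∀ {u} → Pos u → OrderFrame
  wordFrame {u} i₀ = record
    { W        = Pos u
    ; nonEmpty = i₀
    ; order    = λ w x y → w ⪯ x × x ≺ y
    ; domain   = λ w x → w ⪯ x
    ; isStrictWellOrderOn = λ w → record
      { supported = λ (w⪯x , x≺y) → w⪯x , inj₁ (⪯-≺-trans w⪯x x≺y)
      ; isStrictTotalOrder = record
        { isStrictPartialOrder = record
          { isEquivalence = On.isEquivalence proj₁ isEquivalence
          ; irrefl        = λ x≡y (_ , x≺y) → ≺-irrefl x≡y x≺y
          ; trans         = λ (w⪯x , x≺y) (_ , y≺z) → w⪯x , ≺-trans x≺y y≺z
          ; <-resp-≈      = (λ { refl x<y → x<y }) , λ { refl x<y → x<y }
          }
        ; compare = compare w
        }
      ; wellFounded = λ x → accessible w (≺-wellFounded u x)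
      }
    ; centred = λ { (inj₁ w≺x , _) → inj₂ (inj₂ refl , w≺x) ; (inj₂ w≡x , _) → inj₁ w≡x }
    }
    where
    accessible : ∀ w {x} → Acc _≺_ x → Acc (λ x y → w ⪯ x × x ≺ y) x
    accessible w (acc rs) = acc λ (_ , y≺x) → accessible w (rs y≺x)
    compare : ∀ w → Trichotomous {A = ∃ (w ⪯_)} (λ x y → proj₁ x ≡ proj₁ y)
      (λ x y → w ⪯ proj₁ x × proj₁ x ≺ proj₁ y)
    compare w (x , w⪯x) (y , w⪯y) with ≺-cmp x y
    ... | tri< x≺y x≢y y⊀x = tri< (w⪯x , x≺y) x≢y (y⊀x ∘ proj₂)
    ... | tri≈ x⊀y x≡y y⊀x = tri≈ (x⊀y ∘ proj₂) x≡y (y⊀x ∘ proj₂)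
    ... | tri> x⊀y x≢y y≺x = tri> (x⊀y ∘ proj₂) x≢y (w⪯y , y≺x)

  wordFrame-linear : ∀ {u} (i₀ : Pos u) → IsLinear (wordFrame i₀)
  wordFrame-linear i₀ = _≺_ , ≺-isStrictPartialOrder , λ w x y → ⇔-id _

-- Completeness

-- A round robin: every type gets its turn cofinally often and, when there are at least two types,
-- never twice in succession.
turn : ∀ n → ℕ → Fin (suc n)
turn n k = fromℕ< (m%n<n k (suc n))

suc-% : ∀ m d → suc m % suc d ≡ suc (m % suc d) % suc d
suc-% m d = trans (cong (λ x → suc x % suc d) (m≡m%n+[m/n]*n m (suc d)))
  ([m+kn]%n≡m%n (suc (m % suc d)) (m / suc d) (suc d))

toℕ-turn : ∀ n k → toℕ (turn n k) ≡ k % suc n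
toℕ-turn n k = toℕ-fromℕ< (m%n<n k (suc n))

suc-turn-% : ∀ n k → turn (suc n) (suc k) ≡ turn (suc n) k →
  suc (k % suc (suc n)) % suc (suc n) ≡ k % suc (suc n)
suc-turn-% n k eq = begin
  suc (k % suc (suc n)) % suc (suc n) ≡⟨ suc-% k (suc n) ⟨
  suc k % suc (suc n)                 ≡⟨ toℕ-turn (suc n) (suc k) ⟨
  toℕ (turn (suc n) (suc k))          ≡⟨ cong toℕ eq ⟩
  toℕ (turn (suc n) k)                ≡⟨ toℕ-turn (suc n) k ⟩
  k % suc (suc n)                     ∎
  where open ≡-Reasoning

-- Let r be the remainder of k modulo d = n + 2. If r + 1 < d, the next remainder is r + 1;
-- otherwise it is 0, and r = 0 would force d = 1.
turn-suc : ∀ n k → turn (suc n) (suc k) ≢ turn (suc n) k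
turn-suc n k eq with m≤n⇒m<n∨m≡n (m%n<n k d)
  where d = suc (suc n)
... | inj₁ r<d = 1+n≢n (trans (sym (m<n⇒m%n≡m r<d)) (suc-turn-% n k eq))
... | inj₂ r≡d = contradiction (trans (sym r≡d) (cong suc r≡0)) λ ()
  where
  d = suc (suc n)
  r≡0 : k % d ≡ 0
  r≡0 = trans (sym (suc-turn-% n k eq)) (trans (cong (_% d) r≡d) (n%n≡0 d))

turn-recurs : ∀ n i k → ∃ λ m → k ≤ m × turn n m ≡ i
turn-recurs n i k = toℕ i + k * suc n , ≤-trans (m≤m*n k (suc n)) (m≤n+m _ (toℕ i)) ,
  toℕ-injective (begin
    toℕ (turn n (toℕ i + k * suc n)) ≡⟨ toℕ-turn n (toℕ i + k * suc n) ⟩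
    (toℕ i + k * suc n) % suc n      ≡⟨ [m+kn]%n≡m%n (toℕ i) k (suc n) ⟩
    toℕ i % suc n                    ≡⟨ m<n⇒m%n≡m (toℕ<n i) ⟩
    toℕ i                            ∎)
  where open ≡-Reasoning

-- Finite sets of types

Decides : Form → Form → Set
Decides c p = ⊢C2F c →′ p ⊎ ⊢C2F c →′ (¬′ p)

-- The formula ¬⋁S, kept as a conjunction so that members can be removed and reinserted.
none : ∀ {n} → (Fin n → Form) → Form
none {zero}  S = ⊤′
none {suc n} S = (¬′ S zero) ∧′ none (S ∘ suc)

⊢none-elim : ∀ {n} (S : Fin n → Form) i → ⊢C2F none S →′ (¬′ S i)
⊢none-elim S zero    = ⊢proj₁ _ _
⊢none-elim S (suc i) = ⊢trans (⊢proj₂ (¬′ S zero) _) (⊢none-elim (S ∘ suc) i)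

⊢none-intro : ∀ {n} (S : Fin n → Form) {p} → (∀ i → ⊢C2F p →′ (¬′ S i)) → ⊢C2F p →′ none S
⊢none-intro {zero}  S d = ⊢const ⊢⊤
⊢none-intro {suc n} S d = ⊢pair (d zero) (⊢none-intro (S ∘ suc) (d ∘ suc))

⊢none-removeAt : ∀ {n} (S : Fin (suc n) → Form) i → ⊢C2F none S →′ none (removeAt S i)
⊢none-removeAt S i = ⊢none-intro (removeAt S i) λ j → ⊢none-elim S (punchIn i j)

-- State descriptions: conjunctions with one literal for each listed formula, closed off by `⊤′`.
types : List Form → List Form
types []       = ⊤′ ∷ []
types (p ∷ ps) = map (p ∧′_) (types ps) ++ map ((¬′ p) ∧′_) (types ps)

types-decide : ∀ ps {c p} → c ∈ types ps → p ∈ ps → Decides c p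
types-decide (q ∷ ps) c∈ p∈ with ∈-++⁻ (map (q ∧′_) (types ps)) c∈ | p∈
... | inj₁ c∈ˡ | here refl with _ , _ , refl ← ∈-map⁻ _ c∈ˡ = inj₁ (⊢proj₁ _ _)
... | inj₂ c∈ʳ | here refl with _ , _ , refl ← ∈-map⁻ _ c∈ʳ = inj₂ (⊢proj₁ _ _)
... | inj₁ c∈ˡ | there p∈′ with _ , c′∈ , refl ← ∈-map⁻ _ c∈ˡ =
  ⊎-map (⊢trans (⊢proj₂ _ _)) (⊢trans (⊢proj₂ _ _)) (types-decide ps c′∈ p∈′)
... | inj₂ c∈ʳ | there p∈′ with _ , c′∈ , refl ← ∈-map⁻ _ c∈ʳ =
  ⊎-map (⊢trans (⊢proj₂ _ _)) (⊢trans (⊢proj₂ _ _)) (types-decide ps c′∈ p∈′)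

types-cover : ∀ {T} → IsCompleteTheory T → ∀ ps → ∃ λ c → c ∈ types ps × T c
types-cover isT []       = ⊤′ , here refl , IsCompleteTheory.theorems isT ⊢⊤
types-cover isT (p ∷ ps)
  with c , c∈ , Tc ← types-cover isT ps | IsCompleteTheory.complete isT p
... | inj₁ Tp  = p ∧′ c , ∈-++⁺ˡ (∈-map⁺ (p ∧′_) c∈) , IsCompleteTheory.∧-intro isT Tp Tc
... | inj₂ T¬p = (¬′ p) ∧′ c ,
  ∈-++⁺ʳ (map (p ∧′_) (types ps)) (∈-map⁺ ((¬′ p) ∧′_) c∈) ,
  IsCompleteTheory.∧-intro isT T¬p Tc

-- These are the formulas that the types decide; atoms and consequents are read off the labels.
antecedents : Form → List Form
antecedents (atom k) = []
antecedents (¬′ p)   = antecedents p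
antecedents (p ∧′ q) = antecedents p ++ antecedents q
antecedents (p >′ q) = p ∷ antecedents p ++ antecedents q

-- p₁ ∷ … ∷ pₙ ∷ [] stands for the theory f(p₁, … f(pₙ, T) …). It is inconsistent exactly when
-- no world is selected, so that the vacuous case of > needs no separate treatment.
State : Set
State = List Form

-- Theories reached by iterated conditionals

module States {T : Pred Form 0ℓ} (T-complete : IsCompleteTheory T) where

  infix 4 _⊩_ _≐_

  _⊩_ : State → Pred Form 0ℓ
  [] ⊩ q      = T q
  (p ∷ h) ⊩ q = h ⊩ p >′ q

  -- Normality gives closure and conjunction, Identity with closure gives the theorems, and CEM
  -- gives completeness.
  >′-isCompleteTheory : ∀ {T} p → IsCompleteTheory T → IsCompleteTheory λ q → T (p >′ q)
  >′-isCompleteTheory {T} p isT = record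
    { closed   = >′-closed
    ; ∧-intro  = λ {q} {r} pq pr → closed (normality p (⊢refl (q ∧′ r))) (∧-intro pq pr)
    ; theorems = λ d → >′-closed (⊢const d) (theorems (c2 (identity p)))
    ; complete = decide
    }
    where
    open IsCompleteTheory isT
    >′-closed : ∀ {q r} → ⊢C2F q →′ r → T (p >′ q) → T (p >′ r)
    >′-closed d pq = closed (normality p (⊢trans (⊢proj₁ _ _) d)) (∧-intro pq pq)
    decide : ∀ q → T (p >′ q) ⊎ T (p >′ (¬′ q))
    decide q with complete (p >′ q)
    ... | inj₁ pq  = inj₁ pq
    ... | inj₂ ¬pq = inj₂ (resolve (theorems (c2 (cem p q))) ¬pq)

  ⊩-isCompleteTheory : ∀ h → IsCompleteTheory (h ⊩_)
  ⊩-isCompleteTheory []      = T-complete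
  ⊩-isCompleteTheory (p ∷ h) = >′-isCompleteTheory p (⊩-isCompleteTheory h)

  module Theory h = IsCompleteTheory (⊩-isCompleteTheory h)

  -- A record rather than a function type, so that both states can be inferred from it.
  record _≐_ (h g : State) : Set where
    constructor same
    field
      agree : ∀ q → h ⊩ q ⇔ g ⊩ q

  open _≐_

  -- The relation carried through the construction: equality of f(p, h) and f(p, g), which is weaker
  -- than equality of the two theories.
  Agree : Form → Rel State 0ℓ
  Agree p h g = p ∷ h ≐ p ∷ g

  ≐-refl : ∀ {h} → h ≐ h
  ≐-refl = same λ q → ⇔-id _

  ≐-sym : ∀ {h g} → h ≐ g → g ≐ h
  ≐-sym (same e) = same λ q → ⇔-sym (e q)

  ≐-trans : ∀ {h g k} → h ≐ g → g ≐ k → h ≐ k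
  ≐-trans (same e) (same e′) = same λ q → e′ q ⇔-∘ e q

  ≐⇒Agree : ∀ {h g} p → h ≐ g → Agree p h g
  ≐⇒Agree p (same e) = same λ q → e (p >′ q)

  -- Centring. MP passes from p > q to q. Conversely, if p > q fails, CEM gives p > ¬q, and MP then
  -- gives ¬q against q.
  stay : ∀ p h → h ⊩ p → p ∷ h ≐ h
  stay p h h⊩p = same λ q → mk⇔ leave enter
    where
    open Theory h
    leave : ∀ {q} → h ⊩ p >′ q → h ⊩ q
    leave {q} pq = modusPonens (modusPonens (theorems (c2 (mp p q))) pq) h⊩p
    enter : ∀ {q} → h ⊩ q → h ⊩ p >′ q
    enter {q} h⊩q with complete (p >′ q)
    ... | inj₁ pq  = pq
    ... | inj₂ ¬pq = explode h⊩q (leave (resolve (theorems (c2 (cem p q))) ¬pq))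

  -- Reciprocity, with p > q and q > p obtained from Identity and closure.
  equivalent-antecedents : ∀ {p q} h → ⊢C2F p →′ q → ⊢C2F q →′ p → p ∷ h ≐ q ∷ h
  equivalent-antecedents h pq qp = same λ r → mk⇔ (exchange pq qp) (exchange qp pq)
    where
    open Theory h
    exchange : ∀ {p q r} → ⊢C2F p →′ q → ⊢C2F q →′ p → h ⊩ p >′ r → h ⊩ q >′ r
    exchange {p} {q} {r} pq qp pr = modusPonens (theorems (c2 (reciprocity p q r)))
      (∧-intro (∧-intro (Theory.closed (p ∷ h) pq (theorems (c2 (identity p))))
                        (Theory.closed (q ∷ h) qp (theorems (c2 (identity q))))) pr)

  -- Flattening as f(p, h) = f(p, f(s, h)). The axiom speaks of `s ∧′ p`, which is equivalent to p
  -- here, so the antecedent is exchanged before and after its use.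
  skip : ∀ {p s} h → ⊢C2F p →′ s → Agree p h (s ∷ h)
  skip {p} {s} h ps =
    ≐-trans (equivalent-antecedents h p⇒sp sp⇒p)
    (≐-trans flatten (equivalent-antecedents (s ∷ h) sp⇒p p⇒sp))
    where
    open Theory h
    p⇒sp : ⊢C2F p →′ (s ∧′ p)
    p⇒sp = ⊢pair ps (⊢refl p)
    sp⇒p : ⊢C2F (s ∧′ p) →′ p
    sp⇒p = ⊢proj₂ s p
    flatten : (s ∧′ p) ∷ h ≐ (s ∧′ p) ∷ s ∷ h
    flatten = same λ q → mk⇔
      (modusPonens (closed (⊢proj₂ _ _) (theorems (flattening s p q))))
      (modusPonens (closed (⊢proj₁ _ _) (theorems (flattening s p q))))

  none-intro : ∀ {n} (S : Fin n → Form) h → (∀ i → h ⊩ ¬′ S i) → h ⊩ none S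
  none-intro {zero}  S h d = Theory.theorems h ⊢⊤
  none-intro {suc n} S h d = Theory.∧-intro h (d zero) (none-intro (S ∘ suc) h (d ∘ suc))

  none-elim : ∀ {n} (S : Fin n → Form) h i → h ⊩ none S → h ⊩ ¬′ S i
  none-elim S h i = Theory.closed h (⊢none-elim S i)

  none-elim-≢ : ∀ {n} (S : Fin (suc n) → Form) h {i j} → i ≢ j →
    h ⊩ none (removeAt S i) → h ⊩ ¬′ S j
  none-elim-≢ S h i≢j d =
    subst (λ j → h ⊩ ¬′ S j) (punchIn-punchOut i≢j) (none-elim (removeAt S _) h (punchOut i≢j) d)

  none-insert : ∀ {n} (S : Fin (suc n) → Form) h i →
    h ⊩ none (removeAt S i) → h ⊩ ¬′ S i → h ⊩ none S
  none-insert S h i d e = none-intro S h go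
    where
    go : ∀ j → h ⊩ ¬′ S j
    go j with i ≟ j
    ... | yes refl = e
    ... | no i≢j   = none-elim-≢ S h i≢j d

  -- The state in which turn k begins: each earlier turn has left S without the type of that turn.
  exit : ∀ {n} → (Fin (suc n) → Form) → State → ℕ → State
  exit S h zero        = h
  exit {n} S h (suc k) = none (removeAt S (turn n k)) ∷ exit S h k

  -- Realising a finite set of types by a word

  module Construction (em : ExcludedMiddle 0ℓ) where

    -- The states passed through from h until S is left.
    build : ∀ n → (Fin n → Form) → State → Word State
    build zero          S h = nil
    build (suc zero)    S h with em {h ⊩ none S}
    ... | yes _ = nil
    ... | no  _ = leaf h
    build (suc (suc n)) S h = lim λ k →
      build (suc n) (removeAt S (turn (suc n) k)) (exit S h k)

    -- P is the set of positions in view and h′ the state after the word. With `stay`, `first` says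
    -- that f(p, h) is the label of the first p-position in view; if there is none, `rest` passes
    -- the question on to h′.
    record Sees {u} (P : Pred (Pos u) 0ℓ) (h h′ : State) (p : Form) : Set where
      field
        first : ∀ j → P j → label j ⊩ p → (∀ i → P i → i ≺ j → ¬ label i ⊩ p) → Agree p h (label j)
        rest  : (∀ i → P i → ¬ label i ⊩ p) → Agree p h h′

    -- The induction invariant. `start` looks at the word from before its beginning, `later` from
    -- one of its positions. The inclusion in `visits` is in fact an equality, as h is complete and
    -- labels are consistent.
    record Realises {n} (S : Fin n → Form) (h : State) (u : Word State) : Set where
      field
        consistent : ∀ (i : Pos u) {r} → label i ⊩ r → ¬ label i ⊩ ¬′ r
        visits     : ¬ h ⊩ none S → ∃ λ (i : Pos u) → ∀ {r} → h ⊩ r → label i ⊩ r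
        start      : ∀ {p} → (∀ i → Decides (S i) p) → Sees {u} (λ _ → ⊤) h (none S ∷ h) p
        later      : ∀ {p} → (∀ i → Decides (S i) p) → ∀ i → Sees {u} (i ⪯_) (label i) (none S ∷ h) p

    module Limit {n} (S : Fin (suc (suc n)) → Form) (h : State)
      (u : ℕ → Word State)
      (ih : ∀ k → Realises (removeAt S (turn (suc n) k)) (exit S h k) (u k)) where

      open module IH k = Realises (ih k)

      outlet : State
      outlet = none S ∷ h

      -- Leaving S entails leaving each smaller set, so by `skip` the turns already made do not
      -- change where S is left.
      at-outlet : ∀ k → none S ∷ exit S h k ≐ outlet
      at-outlet zero    = ≐-refl
      at-outlet (suc k) = ≐-trans
        (≐-sym (skip (exit S h k) (⊢none-removeAt S (turn (suc n) k)))) (at-outlet k)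

      module _ {p} (dec : ∀ i → Decides (S i) p) where

        Absent : Pred ℕ 0ℓ
        Absent k = ∀ (i : Pos (u k)) → ¬ label i ⊩ p

        link : ∀ {k} → Absent k → Agree p (exit S h k) (exit S h (suc k))
        link {k} absent = Sees.rest (start k (dec ∘ punchIn _)) λ i _ → absent i

        links : ∀ {k m} → k ≤′ m → (∀ l → k ≤ l → l < m → Absent l) →
          Agree p (exit S h k) (exit S h m)
        links ≤′-refl _ = ≐-refl
        links (≤′-step {m} k≤m) absent = ≐-trans
          (links k≤m λ l k≤l l<m → absent l k≤l (m≤n⇒m≤1+n l<m))
          (link (absent m (≤′⇒≤ k≤m) ≤-refl))

        -- A turn of s ends outside S or at s; in the latter case the next turn, being that of
        -- another type, would record this end state, in which p holds.
        leaves : ∀ {m} → (∀ l → m ≤ l → Absent l) → ⊢C2F S (turn (suc n) m) →′ p →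
          exit S h (suc m) ⊩ none S
        leaves {m} absent Si⇒p with complete (none S) | complete (S (turn (suc n) m))
          where open Theory (exit S h (suc m))
        ... | inj₁ out  | _        = out
        ... | inj₂ _    | inj₂ ¬Si = none-insert S (exit S h (suc m)) (turn (suc n) m)
          (Theory.theorems (exit S h m) (c2 (identity _))) ¬Si
        ... | inj₂ ¬out | inj₁ Si  = decidable-stable em λ ¬none →
          let i , sub = visits (suc m) λ out → ¬none (explode Si
                (none-elim-≢ S (exit S h (suc m)) (turn-suc n m) out))
          in absent (suc m) (m≤n⇒m≤1+n ≤-refl) i (sub (closed Si⇒p Si))
          where open Theory (exit S h (suc m))

        -- If no type in S entails p, then p entails ¬⋁S and `skip` applies. If type i does, go on
        -- to a turn of i: by `leaves` the state after it is already outside S, hence equals the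
        -- outlet.
        absent⇒Agree : ∀ k → (∀ l → k ≤ l → Absent l) → Agree p (exit S h k) outlet
        absent⇒Agree k absent with em {∃ λ i → ⊢C2F S i →′ p}
        ... | no never = ≐-trans (skip (exit S h k) (⊢none-intro S excludes))
                                 (≐⇒Agree p (at-outlet k))
          where
          excludes : ∀ i → ⊢C2F p →′ (¬′ S i)
          excludes i with dec i
          ... | inj₁ Si⇒p  = contradiction (i , Si⇒p) never
          ... | inj₂ Si⇒¬p = ⊢contrapose Si⇒¬p
        ... | yes (i , Si⇒p) with m , k≤m , refl ← turn-recurs (suc n) i k =
          ≐-trans (links (≤⇒≤′ (m≤n⇒m≤1+n k≤m)) λ l k≤l _ → absent l k≤l)
          (≐⇒Agree p (≐-trans
            (≐-sym (stay _ _ (leaves (λ l m≤l → absent l (≤-trans k≤m m≤l)) Si⇒p)))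
            (at-outlet (suc m))))

      realises : Realises S h (lim u)
      realises = record
        { consistent = λ { (at k i) → consistent k i }
        ; visits     = visit
        ; start      = λ dec → record { first = start-first dec ; rest = start-rest dec }
        ; later      = λ dec i → record { first = later-first dec i ; rest = later-rest dec i }
        }
        where
        stayed : h ⊩ none (removeAt S (turn (suc n) 0)) → exit S h 1 ≐ h
        stayed = stay _ h

        -- If h is outside S without the type of turn 0, then that turn leaves the theory unchanged;
        -- turn 1 drops a different type and so visits it.
        visit : ¬ h ⊩ none S → ∃ λ (i : Pos (lim u)) → ∀ {r} → h ⊩ r → label i ⊩ r
        visit ¬out with em {h ⊩ none (removeAt S (turn (suc n) 0))}
        ... | no ¬out₀ = let i , sub = visits 0 ¬out₀ in at 0 i , sub
        ... | yes out₀ = let i , sub = visits 1 ¬out₁ in at 1 i , λ {r} d → sub (from (agree (stayed out₀) r) d)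
          where
          ¬out₁ : ¬ exit S h 1 ⊩ none (removeAt S (turn (suc n) 1))
          ¬out₁ out₁ = ¬out (none-insert S h (turn (suc n) 0) out₀
            (to (agree (stayed out₀) _) (none-elim-≢ S (exit S h 1) (turn-suc n 0) out₁)))

        module _ {p} (dec : ∀ i → Decides (S i) p) where

          start-first : ∀ (j : Pos (lim u)) → ⊤ → label j ⊩ p →
            (∀ i → ⊤ → i ≺ j → ¬ label i ⊩ p) → Agree p h (label j)
          start-first (at k j) _ pj least = ≐-trans
            (links dec (z≤′n {k}) λ l _ l<k i → least (at l i) tt (outer l<k))
            (Sees.first (start k (dec ∘ punchIn _)) j tt pj λ i _ i≺j → least (at k i) tt (inner i≺j))

          start-rest : (∀ (i : Pos (lim u)) → ⊤ → ¬ label i ⊩ p) → Agree p h outlet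
          start-rest absent = absent⇒Agree dec 0 λ l _ i → absent (at l i) tt

          at-⪯ : ∀ {k} {i j : Pos (u k)} → i ⪯ j → at {f = u} k i ⪯ at k j
          at-⪯ (inj₁ i≺j)  = inj₁ (inner i≺j)
          at-⪯ (inj₂ refl) = inj₂ refl

          later-inner : ∀ {k} (i j : Pos (u k)) → i ⪯ j → label j ⊩ p →
            (∀ x → at k i ⪯ x → x ≺ at k j → ¬ label x ⊩ p) → Agree p (label i) (label j)
          later-inner {k} i j i⪯j pj least =
            Sees.first (later k (dec ∘ punchIn _) i) j i⪯j pj λ x i⪯x x≺j →
              least (at k x) (at-⪯ i⪯x) (inner x≺j)

          later-first : ∀ i (j : Pos (lim u)) → i ⪯ j → label j ⊩ p →
            (∀ x → i ⪯ x → x ≺ j → ¬ label x ⊩ p) → Agree p (label i) (label j)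
          later-first (at k i) (at _ j) (inj₁ (inner i≺j)) pj least = later-inner i j (inj₁ i≺j) pj least
          later-first (at k i) (at _ j) (inj₂ refl) pj least = later-inner i j (inj₂ refl) pj least
          -- Three stretches are crossed: the rest of block k, the blocks strictly between, and
          -- block m up to j. The outlet of block k is by definition the state starting block k + 1.
          later-first (at k i) (at m j) (inj₁ (outer k<m)) pj least = ≐-trans
            (Sees.rest (later k (dec ∘ punchIn _) i) λ x i⪯x → least (at k x) (at-⪯ i⪯x) (outer k<m))
            (≐-trans (links dec (≤⇒≤′ k<m) λ l k<l l<m x → least (at l x) (inj₁ (outer k<l)) (outer l<m))
            (Sees.first (start m (dec ∘ punchIn _)) j tt pj λ x _ x≺j →
              least (at m x) (inj₁ (outer k<m)) (inner x≺j)))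

          later-rest : ∀ (i : Pos (lim u)) → (∀ x → i ⪯ x → ¬ label x ⊩ p) → Agree p (label i) outlet
          later-rest (at k i) absent = ≐-trans
            (Sees.rest (later k (dec ∘ punchIn _) i) λ x i⪯x → absent (at k x) (at-⪯ i⪯x))
            (absent⇒Agree dec (suc k) λ l k<l x → absent (at l x) (inj₁ (outer k<l)))

    build-realises : ∀ n (S : Fin n → Form) h → Realises S h (build n S h)
    build-realises zero S h = record
      { consistent = λ ()
      ; visits     = λ ¬out → contradiction (Theory.theorems h ⊢⊤) ¬out
      ; start      = λ dec → record
        { first = λ ()
        ; rest  = λ _ → ≐⇒Agree _ (≐-sym (stay _ _ (Theory.theorems h ⊢⊤)))
        }
      ; later      = λ dec ()
      }
    build-realises (suc zero) S h with em {h ⊩ none S}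
    ... | yes out = record
      { consistent = λ ()
      ; visits     = λ ¬out → contradiction out ¬out
      ; start      = λ dec → record
        { first = λ ()
        ; rest  = λ _ → ≐⇒Agree _ (≐-sym (stay _ h out))
        }
      ; later      = λ dec ()
      }
    ... | no ¬out = record
      -- An inconsistent h would contain ¬⋁S.
      { consistent = λ { here d e → ¬out (Theory.explode h d e) }
      ; visits     = λ _ → here , id
      ; start      = λ dec → record
        { first = λ { here _ _ _ → ≐-refl }
        ; rest  = λ absent → unseen dec (absent here tt)
        }
      ; later      = λ { dec here → record
        { first = λ { here _ _ _ → ≐-refl }
        ; rest  = λ absent → unseen dec (absent here (inj₂ refl))
        } }
      }
      where
      -- Why one leaf is enough for one type: h is of that type and lacks p, so the type excludes p;
      -- then p entails leaving it, and `skip` applies.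
      unseen : ∀ {p} → (∀ i → Decides (S i) p) → ¬ h ⊩ p → Agree p h (none S ∷ h)
      unseen dec ¬p with dec zero | Theory.complete h (S zero)
      ... | _      | inj₂ ¬S = contradiction (none-intro S h λ { zero → ¬S }) ¬out
      ... | inj₁ d | inj₁ S∈ = contradiction (Theory.closed h d S∈) ¬p
      ... | inj₂ d | inj₁ _  = skip h (⊢none-intro S λ { zero → ⊢contrapose d })
    build-realises (suc (suc n)) S h =
      Limit.realises S h _ λ k → build-realises (suc n) (removeAt S (turn (suc n) k)) (exit S h k)

    -- The truth lemma

    module Truth {n} (S : Fin n → Form) (h : State) {u : Word State} (realised : Realises S h u)
      (exhausted : ∀ q → none S ∷ h ⊩ q) (i₀ : Pos u) where

      open Realises realised

      model : OrderModel
      model = record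
        { frame = wordFrame i₀
        ; V     = λ k i → does (em {label i ⊩ atom k})
        }

      open OrderModel model using (⟦_⟧; R)

      R⇒⪯ : ∀ {i j} → R i j → i ⪯ j
      R⇒⪯ (inj₁ refl)      = inj₂ refl
      R⇒⪯ (inj₂ (_ , i≺j)) = inj₁ i≺j

      ⪯⇒R : ∀ {i j} → i ⪯ j → R i j
      ⪯⇒R (inj₁ i≺j)  = inj₂ (inj₂ refl , i≺j)
      ⪯⇒R (inj₂ refl) = inj₁ refl

      truth : ∀ p → (∀ {a} → a ∈ antecedents p → ∀ i → Decides (S i) a) →
        ∀ i → label i ⊩ p ⇔ ⟦ p ⟧ i
      truth (atom k) dec i with em {label i ⊩ atom k}
      ... | yes d = mk⇔ (λ _ → refl) (λ _ → d)
      ... | no ¬d = mk⇔ (λ d → contradiction d ¬d) (λ ())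
      truth (¬′ p) dec i = mk⇔
        (λ ¬p p∈ → consistent i (from (truth p dec i) p∈) ¬p)
        (λ ¬p → [ (λ p∈ → contradiction (to (truth p dec i) p∈) ¬p) , id ]′
          (Theory.complete (label i) p))
      truth (p ∧′ q) dec i = mk⇔
        (λ pq → to ihp (closed (⊢proj₁ p q) pq) , to ihq (closed (⊢proj₂ p q) pq))
        (λ (p∈ , q∈) → ∧-intro (from ihp p∈) (from ihq q∈))
        where
        open Theory (label i)
        ihp = truth p (dec ∘ ∈-++⁺ˡ) i
        ihq = truth q (dec ∘ ∈-++⁺ʳ (antecedents p)) i
      -- If j is the first p-position from i, `first` makes the labels of i and j agree on
      -- antecedent p, and `stay` identifies f(p, label j) with label j. So p > q at i amounts to q
      -- at j.
      truth (p >′ q) dec i = mk⇔ f g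
        where
        ihp = truth p (dec ∘ there ∘ ∈-++⁺ˡ)
        ihq = truth q (dec ∘ there ∘ ∈-++⁺ʳ (antecedents p))
        sees : Sees (i ⪯_) (label i) (none S ∷ h) p
        sees = later (dec (here refl)) i
        f : label i ⊩ p >′ q → ⟦ p >′ q ⟧ i
        f pq with em {∃ λ j → i ⪯ j × ⟦ p ⟧ j}
        ... | no never = inj₁ λ j (Rij , pj) → never (j , R⇒⪯ Rij , pj)
        ... | yes occurs with j , (i⪯j , pj) , least ←
                minimal em (≺-wellFounded u) (λ j → i ⪯ j × ⟦ p ⟧ j) occurs =
          inj₂ (j , (⪯⇒R i⪯j , pj , to (ihq j) (to (agree (stay p (label j) p∈j) q) (to (agree selected q) pq))) ,
                λ x (i⪯x , x≺j) px → least x x≺j (i⪯x , px))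
          where
          p∈j : label j ⊩ p
          p∈j = from (ihp j) pj
          selected : Agree p (label i) (label j)
          selected = Sees.first sees j i⪯j p∈j λ x i⪯x x≺j px → least x x≺j (i⪯x , to (ihp x) px)
        g : ⟦ p >′ q ⟧ i → label i ⊩ p >′ q
        -- With no p-position in view, agreement reaches the final exit, which contains every
        -- formula and so also p > q.
        g (inj₁ never) = from (agree (Sees.rest sees λ j i⪯j p∈j → never j (⪯⇒R i⪯j , to (ihp j) p∈j)) q)
          (exhausted (p >′ q))
        g (inj₂ (j , (Rij , pj , qj) , least)) =
          from (agree (Sees.first sees j (R⇒⪯ Rij) p∈j λ x i⪯x x≺j px → least x (i⪯x , x≺j) (to (ihp x) px)) q)
            (from (agree (stay p (label j) p∈j) q) (from (ihq j) qj))
          where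
          p∈j : label j ⊩ p
          p∈j = from (ihp j) pj

theorem4p5 : ExcludedMiddle 0ℓ →
    ∀ (p : Form) →
    (⊢C2F p) ⇔
    (∀ (M : OrderModel) → IsLinear (OrderModel.frame M) →
    ∀ (w : OrderModel.W M) → OrderModel.TrueAt M p w)
theorem4p5 em p = mk⇔ (λ d M lin → Soundness.C2F-sound em M lin d) complete
  where
  complete : (∀ (M : OrderModel) → IsLinear (OrderModel.frame M) →
    ∀ (w : OrderModel.W M) → OrderModel.TrueAt M p w) → ⊢C2F p
  complete valid = decidable-stable em λ ⊬p → refute λ d → ⊬p (⊢stable d)
    where
    refute : ¬ Lindenbaum.Consistent em (¬′ p)
    -- The initial theory contains ¬p, hence so does label i; validity and the truth lemma put p
    -- there too.
    refute con = consistent i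
      (from (truth p decided i) (valid model (wordFrame-linear i) i))
      (proj₂ occurrence (extension-base (¬′ p) con))
      where
      open Lindenbaum em
      open States (extension-isCompleteTheory (¬′ p) con)
      open Construction em
      as = antecedents p
      S : Fin (length (types as)) → Form
      S = lookup (types as)
      realised : Realises S [] (build _ S [])
      realised = build-realises _ S []
      open Realises realised
      -- Every complete theory contains one of the types, so a theory that rejects them all is
      -- inconsistent.
      none⇒inconsistent : ∀ h {q} → h ⊩ none S → h ⊩ q
      none⇒inconsistent h out with c , c∈ , h⊩c ← types-cover (⊩-isCompleteTheory h) as =
        Theory.explode h (subst (h ⊩_) (lookup-index c∈) h⊩c) (none-elim S h (index c∈) out)
      occurrence : ∃ λ (i : Pos (build _ S [])) → ∀ {r} → [] ⊩ r → label i ⊩ r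
      occurrence = visits λ out → extension-consistent (¬′ p) con
        (none⇒inconsistent [] out) (none⇒inconsistent [] {¬′ p} out)
      i = proj₁ occurrence
      open Truth S [] realised
        -- By Identity the final exit contains ¬⋁S.
        (λ q → none⇒inconsistent (none S ∷ []) (Theory.theorems [] (c2 (identity _)))) i
      decided : ∀ {a} → a ∈ as → ∀ i → Decides (S i) a
      decided a∈ i = types-decide as (∈-lookup i) a∈
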